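{- The class of $(\overline{P_1+P_4},\,P_1+2P_2)$-free graphs is not well-quasi-ordered by the induced subgraph relation.
   Context: Graphs are finite, undirected and simple. $P_r$ is the path on $r$ vertices, $G+H$ is the disjoint union of vertex-disjoint graphs $G,H$, $rG$ is the disjoint union of $r$ copies of $G$, and $\overline{G}$ is the complement of $G$. A graph is $(H_1,\ldots,H_p)$-free if it has no induced subgraph isomorphic to any of $H_1,\ldots,H_p$. The induced subgraph relation is the quasi-order in which $H\leq G$ if and only if $H$ is isomorphic to an induced subgraph of $G$. A quasi-order $\leq$ on a set (or class) $X$ is a well-quasi-order if every infinite sequence $x_1,x_2,\ldots$ in $X$ contains a pair with $x_i\leq x_j$, $i<j$ (equivalently: no infinite strictly decreasing sequence and no infinite antichain). -}

module Defs where

open import Data.Bool using (true; false)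
open import Data.Fin using (Fin; zero; suc; toℕ; splitAt)
open import Data.Fin.Properties using (_≟_; suc-injective)
open import Data.Fin.Subset using (Subset; ∣_∣)
open import Data.List using (List)
open import Data.List.Relation.Unary.All using (All)
open import Data.Nat as ℕ using (ℕ; zero; suc; _<_)
open import Data.Nat.Properties using (1+n≢n)
open import Data.Product using (Σ; ∃-syntax; _×_; _,_; proj₁)
open import Data.Sum using (_⊎_; inj₁; inj₂; swap)
open import Data.Sum.Relation.Binary.Pointwise
  using (Pointwise; inj₁; inj₂; ⊎-symmetric; ⊎-decidable)
open import Data.Vec using (_∷_)
open import Function using (_on_; _∘_; _↔_; _⇔_; Inverse)
open import Level using (Level; 0ℓ)
open import Relation.Binary using (Rel; Symmetric; Decidable)
open import Relation.Binary.PropositionalEquality using (_≡_; _≢_; refl; cong; ≢-sym)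
open import Relation.Nullary using (¬_; ¬?; _×-dec_; _⊎-dec_)
open import Relation.Unary using (Pred)

record Graph : Set₁ where
  infix 4 _∼_
  field
    order  : ℕ
    _∼_    : Rel (Fin order) 0ℓ
    irrefl : ∀ {v} → ¬ (v ∼ v)
    sym    : Symmetric _∼_
    _∼?_   : Decidable _∼_

  Vertex : Set
  Vertex = Fin order

open Graph using (Vertex)

P : ℕ → Graph
P r = record
  { order  = r
  ; _∼_    = λ i j → suc (toℕ i) ≡ toℕ j ⊎ suc (toℕ j) ≡ toℕ i
  ; irrefl = λ { (inj₁ e) → 1+n≢n e ; (inj₂ e) → 1+n≢n e }
  ; sym    = swap
  ; _∼?_   = λ i j → (suc (toℕ i) ℕ.≟ toℕ j) ⊎-dec (suc (toℕ j) ℕ.≟ toℕ i)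
  }

infixl 6 _+_
_+_ : Graph → Graph → Graph
G + H = record
  { order  = G.order ℕ.+ H.order
  ; _∼_    = Pointwise G._∼_ H._∼_ on splitAt G.order
  ; irrefl = λ {v} → irrefl⊎ (splitAt G.order v)
  ; sym    = ⊎-symmetric G.sym H.sym
  ; _∼?_   = λ u v → ⊎-decidable G._∼?_ H._∼?_ (splitAt G.order u) (splitAt G.order v)
  }
  where
  module G = Graph G
  module H = Graph H
  irrefl⊎ : ∀ x → ¬ Pointwise G._∼_ H._∼_ x x
  irrefl⊎ (inj₁ _) (inj₁ e) = G.irrefl e
  irrefl⊎ (inj₂ _) (inj₂ e) = H.irrefl e

infixr 7 _·_
_·_ : ℕ → Graph → Graph
zero  · G = P 0
suc r · G = G + r · G

complement : Graph → Graph
complement G = record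
  { order  = order
  ; _∼_    = λ u v → u ≢ v × ¬ (u ∼ v)
  ; irrefl = λ (v≢v , _) → v≢v refl
  ; sym    = λ (u≢v , u≁v) → ≢-sym u≢v , u≁v ∘ sym
  ; _∼?_   = λ u v → ¬? (u ≟ v) ×-dec ¬? (u ∼? v)
  }
  where open Graph G

-- The i-th element of S, in increasing order.
element : ∀ {n} (S : Subset n) → Fin ∣ S ∣ → Fin n
element (true  ∷ S) zero    = zero
element (true  ∷ S) (suc i) = suc (element S i)
element (false ∷ S) i       = suc (element S i)

element-injective : ∀ {n} (S : Subset n) {i j} → element S i ≡ element S j → i ≡ j
element-injective (true  ∷ S) {zero}  {zero}  _ = refl
element-injective (true  ∷ S) {suc _} {suc _} e =
  cong suc (element-injective S (suc-injective e))
element-injective (false ∷ S) e = element-injective S (suc-injective e)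

-- The subgraph of G induced by S; its vertex i stands for the vertex
-- element S i of G.
_[_] : (G : Graph) → Subset (Graph.order G) → Graph
G [ S ] = record
  { order  = ∣ S ∣
  ; _∼_    = _∼_ on element S
  ; irrefl = irrefl
  ; sym    = sym
  ; _∼?_   = λ i j → element S i ∼? element S j
  }
  where open Graph G

infix 4 _≅_ _≼_
record _≅_ (G H : Graph) : Set where
  private
    module G = Graph G
    module H = Graph H
  field
    bijection : Vertex G ↔ Vertex H
  open Inverse bijection public using (to; from)
  field
    adjacency : ∀ u v → u G.∼ v ⇔ to u H.∼ to v

_≼_ : Rel Graph 0ℓ
H ≼ G = ∃[ S ] H ≅ G [ S ]

Free : List Graph → Pred Graph _
Free Hs G = All (λ H → ¬ (H ≼ G)) Hs

-- The condition defining well-quasi-orders among quasi-orders.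
WellQuasiOrdered : ∀ {a ℓ : Level} {X : Set a} → Rel X ℓ → Set _
WellQuasiOrdered {X = X} _≤_ =
  (x : ℕ → X) → ∃[ i ] ∃[ j ] i < j × x i ≤ x j

ClassWellQuasiOrdered : ∀ {ℓ} → Pred Graph ℓ → Set _
ClassWellQuasiOrdered C = WellQuasiOrdered {X = Σ Graph C} (_≼_ on proj₁)

{-# OPTIONS --safe #-}
module Submission where

-- View a cycle of length 4n as a word of period AABB.  Replace the edges
-- inside A, and those inside B, by the non-edges: A and B become complements
-- of perfect matchings, joined to each other by a perfect matching.  Every
-- triangle lies in A or in B, and every vertex has exactly one non-neighbour
-- on its own side; hence no gem and no P₁ + 2P₂.  An induced embedding
-- between two such graphs respects sides (through common neighbours), and so
-- commutes with "the non-neighbour on the own side" and "the neighbour on the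
-- other side".  Alternating these two maps walks around the whole cycle, so
-- the embedding is onto, and no graph embeds in a larger one.

open import Defs
open import Data.Bool using (Bool; true; false; not)
import Data.Bool.Properties as Bool
open import Data.Empty using (⊥)
open import Data.Fin using (Fin; zero; suc; inject₁; opposite; #_)
open import Data.Fin.Induction using (<-weakInduction; >-weakInduction)
open import Data.Fin.Properties using (_≟_; *↔×; 2↔Bool; opposite-involutive; injective⇒≤)
open import Data.List using (_∷_; [])
open import Data.List.Relation.Unary.All using (_∷_; [])
open import Data.Nat as ℕ using (ℕ; _≤_)
open import Data.Nat.Properties using (+-cancelˡ-≤; *-cancelˡ-≤; <⇒≱)
open import Data.Product using (∃-syntax; _×_; _,_; proj₁; proj₂)
open import Data.Product.Function.NonDependent.Propositional using (_×-↔_)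
open import Data.Product.Properties using (≡-dec)
open import Data.Sum using (_⊎_; inj₁; inj₂)
open import Function using (_∘_; case_of_; _↔_; _⇔_; Equivalence; Inverse; Injection)
open import Function.Construct.Composition using (_↔-∘_)
open import Function.Construct.Identity using (↔-id)
open import Function.Definitions using (Injective)
open import Function.Properties.Inverse using (Inverse⇒Injection)
open import Level using (0ℓ)
open import Relation.Binary using (Rel; Symmetric; DecidableEquality)
open import Relation.Binary.PropositionalEquality
  using (_≡_; _≢_; refl; sym; trans; cong; subst; subst₂; ≢-sym)
open import Relation.Nullary using (¬_; Dec; yes; no; ¬?; _×-dec_; _⊎-dec_; contradiction)
open import Relation.Nullary.Decidable using (True; toWitness; False; toWitnessFalse)

open Graph using (Vertex)

avoid-two : ∀ {n} (p q : Fin (3 ℕ.+ n)) → ∃[ r ] r ≢ p × r ≢ q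
avoid-two (suc _)       (suc _)       = zero , (λ ()) , λ ()
avoid-two zero          zero          = suc zero , (λ ()) , λ ()
avoid-two zero          (suc zero)    = suc (suc zero) , (λ ()) , λ ()
avoid-two zero          (suc (suc _)) = suc zero , (λ ()) , λ ()
avoid-two (suc zero)    zero          = suc (suc zero) , (λ ()) , λ ()
avoid-two (suc (suc _)) zero          = suc zero , (λ ()) , λ ()

-- The first coordinate says whether the vertex lies in A or in B.
V : ℕ → Set
V n = Bool × Bool × Fin (3 ℕ.+ n)

-- The two sides, their matchings and the walk along them.

module _ {n : ℕ} where

  infix 4 _≟V_ _~_ _~?_

  _≟V_ : DecidableEquality (V n)
  _≟V_ = ≡-dec Bool._≟_ (≡-dec Bool._≟_ _≟_)

  side : V n → Bool
  side = proj₁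

  -- With indices read modulo 3 + n, these are i ↦ -1 - i and i ↦ -i;
  -- their composite is a rotation.  Using two reflections instead of a shift
  -- makes both partner maps involutions by the same formula.
  reflect : Bool → Fin (3 ℕ.+ n) → Fin (3 ℕ.+ n)
  reflect false i       = opposite i
  reflect true  zero    = zero
  reflect true  (suc i) = suc (opposite i)

  partner mate : V n → V n
  partner (c , b , i) = c , not b , reflect c i
  mate    (c , b , i) = not c , b , i

  _~_ : Rel (V n) 0ℓ
  x ~ y = (side x ≡ side y × x ≢ y × y ≢ partner x) ⊎ y ≡ mate x

  _~?_ : ∀ x y → Dec (x ~ y)
  x ~? y =
    (side x Bool.≟ side y ×-dec ¬? (x ≟V y) ×-dec ¬? (y ≟V partner x)) ⊎-dec (y ≟V mate x)

  reflect-involutive : ∀ c i → reflect c (reflect c i) ≡ i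
  reflect-involutive false i       = opposite-involutive i
  reflect-involutive true  zero    = refl
  reflect-involutive true  (suc i) = cong suc (opposite-involutive i)

  partner-involutive : ∀ x → partner (partner x) ≡ x
  partner-involutive (c , b , i)
    rewrite Bool.not-involutive b | reflect-involutive c i = refl

  partner≢ : ∀ {x} → partner x ≢ x
  partner≢ {c , b , i} e = Bool.not-¬ {b} refl (sym (cong (proj₁ ∘ proj₂) e))

  mate-involutive : ∀ x → mate (mate x) ≡ x
  mate-involutive (c , k) = cong (_, k) (Bool.not-involutive c)

  mate-side : ∀ x → side x ≢ side (mate x)
  mate-side _ = Bool.not-¬ refl

  ~-irrefl : ∀ {x} → ¬ (x ~ x)
  ~-irrefl     (inj₁ (_ , x≢x , _)) = x≢x refl
  ~-irrefl {x} (inj₂ x≡mate)        = mate-side x (cong side x≡mate)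

  ~-sym : Symmetric _~_
  ~-sym {x} {y} (inj₁ (s , x≢y , y≢px)) =
    inj₁ (sym s , ≢-sym x≢y ,
          λ x≡py → y≢px (trans (sym (partner-involutive y)) (cong partner (sym x≡py))))
  ~-sym {x} (inj₂ refl) = inj₂ (sym (mate-involutive x))

  ≁⇒partner : ∀ {x y} → side x ≡ side y → x ≢ y → ¬ (x ~ y) → y ≡ partner x
  ≁⇒partner {x} {y} s x≢y x≁y with y ≟V partner x
  ... | yes e = e
  ... | no ne = contradiction (inj₁ (s , x≢y , ne)) x≁y

  ~⇒mate : ∀ {x y} → side x ≢ side y → x ~ y → y ≡ mate x
  ~⇒mate s≢ (inj₁ (s , _)) = contradiction s s≢
  ~⇒mate s≢ (inj₂ e)       = e

  non-neighbour-unique : ∀ {x y z} → side x ≡ side y → side x ≡ side z →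
    x ≢ y → x ≢ z → ¬ (x ~ y) → ¬ (x ~ z) → y ≡ z
  non-neighbour-unique xy xz x≢y x≢z x≁y x≁z =
    trans (≁⇒partner xy x≢y x≁y) (sym (≁⇒partner xz x≢z x≁z))

  -- If the edge from `x` to `y` crossed, `z` would lie opposite one of them, giving that vertex two
  -- neighbours across; it has only its mate.
  triangle-side : ∀ {x y z} → x ~ y → x ~ z → y ~ z → side x ≡ side y
  triangle-side (inj₁ (s , _)) _ _ = s
  triangle-side (inj₂ refl) (inj₂ refl) y~z = contradiction y~z ~-irrefl
  triangle-side (inj₂ refl) (inj₁ (xz , _)) (inj₁ (yz , _)) = trans xz (sym yz)
  triangle-side {x} (inj₂ refl) x~z (inj₂ refl) =
    contradiction (subst (x ~_) (mate-involutive x) x~z) ~-irrefl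

  -- Of `x` and `partner x`, exactly one has second coordinate `false`; this is its index.
  representative : V n → Fin (3 ℕ.+ n)
  representative (c , false , i) = i
  representative (c , true  , i) = reflect c i

  representative-~ : ∀ x {j} → j ≢ representative x → x ~ (side x , false , j)
  representative-~ (c , false , i) j≢ =
    inj₁ (refl , (λ { refl → j≢ refl }) , λ ())
  representative-~ (c , true , i) j≢ =
    inj₁ (refl , (λ ()) , λ e → j≢ (cong (proj₂ ∘ proj₂) e))

  -- Every vertex of a side is adjacent to all vertices there with second coordinate `false`, except
  -- the one at its `representative`. Three of them suffice to leave one adjacent to both `x` and
  -- `y`.
  common-neighbour : ∀ x y → side x ≡ side y → ∃[ z ] side x ≡ side z × x ~ z × y ~ z
  common-neighbour x@(c , _) y refl
    with j , j≢x , j≢y ← avoid-two (representative x) (representative y) =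
    (c , false , j) , refl , representative-~ x j≢x , representative-~ y j≢y

  -- The composite of the two reflections is the cyclic predecessor.
  reflections-transitive : ∀ {ℓ} (Q : Fin (3 ℕ.+ n) → Set ℓ) →
    (∀ i → Q i → Q (reflect false (reflect true i))) → ∀ {i} → Q i → ∀ j → Q j
  reflections-transitive Q step {i} q =
    -- Descend from `i` to zero, wrap around to the last index, then descend to any target.
    >-weakInduction Q (step zero (reach-zero i q)) down
    where
    down : ∀ j → Q (suc j) → Q (inject₁ j)
    down j q = subst (Q ∘ inject₁) (opposite-involutive j) (step (suc j) q)
    reach-zero : ∀ i → Q i → Q zero
    reach-zero = <-weakInduction (λ i → Q i → Q zero) (λ q → q) (λ i ih → ih ∘ down i)

  -- From side `true`, applying `partner`, `mate`, `partner`, `mate` rotates the index and restores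
  -- the other coordinates; a single `partner` or `mate` adjusts those.
  transitive : ∀ {ℓ} (Q : V n → Set ℓ) → (∀ x → Q x → Q (partner x)) →
    (∀ x → Q x → Q (mate x)) → ∀ {x} → Q x → ∀ y → Q y
  transitive Q p m {c , b , i} q (c′ , b′ , j) = move-side c c′ (move-index j)
    where
    move-side : ∀ c c′ {b i} → Q (c , b , i) → Q (c′ , b , i)
    move-side false false = λ q → q
    move-side false true  = m _
    move-side true  false = m _
    move-side true  true  = λ q → q
    rotate : ∀ b i → Q (true , b , i) → Q (true , b , reflect false (reflect true i))
    rotate b i q = subst (λ b → Q (true , b , _)) (Bool.not-involutive b)
      (m _ (p _ (m _ (p (true , b , i) q))))
    start : ∀ b′ → ∃[ i′ ] Q (true , b′ , i′)
    start b′ with b′ Bool.≟ b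
    ... | yes refl = i , move-side c true q
    ... | no  b′≢b rewrite Bool.¬-not b′≢b = _ , p _ (move-side c true q)
    move-index : ∀ j → Q (c , b′ , j)
    move-index j = move-side true c
      (reflections-transitive (λ i → Q (true , b′ , i)) (rotate b′) (proj₂ (start b′)) j)

-- Rigidity of embeddings.

module _ {m n} (f : V m → V n) (f-injective : Injective _≡_ _≡_ f)
         (f-~ : ∀ x y → x ~ y ⇔ f x ~ f y) where

  private
    preserves : ∀ {x y} → x ~ y → f x ~ f y
    preserves = Equivalence.to (f-~ _ _)

    reflects : ∀ {x y} → ¬ (x ~ y) → ¬ (f x ~ f y)
    reflects x≁y = x≁y ∘ Equivalence.from (f-~ _ _)

  -- An edge within a side lies in a triangle, whose image stays on one side; two such edges through
  -- a common neighbour link any `x` and `y` on a side.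
  embedding-same-side : ∀ {x y} → side x ≡ side y → side (f x) ≡ side (f y)
  embedding-same-side {x} {y} s
    with z , xz , x~z , y~z ← common-neighbour x y s =
    trans (neighbours xz x~z) (sym (neighbours (trans (sym s) xz) y~z))
    where
    neighbours : ∀ {x y} → side x ≡ side y → x ~ y → side (f x) ≡ side (f y)
    neighbours {x} {y} s x~y with z , _ , x~z , y~z ← common-neighbour x y s =
      triangle-side (preserves x~y) (preserves x~z) (preserves y~z)

  -- Otherwise the whole side opposite `x` would land on the side of `f x`, where `f x` would have
  -- two non-neighbours, the images of `w zero` and `w (suc zero)`.
  embedding-mate-side : ∀ x → side (f x) ≢ side (f (mate x))
  embedding-mate-side x@(c , b , _) s =
    case f-injective (non-neighbour-unique (same zero) (same (suc zero))
      (x≢w ∘ f-injective) (x≢w ∘ f-injective) (reflects x≁w) (reflects x≁w))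
    of λ ()
    where
    w : Fin (3 ℕ.+ m) → V m
    w j = not c , not b , j
    same : ∀ j → side (f x) ≡ side (f (w j))
    same j = trans s (embedding-same-side refl)
    x≢w : ∀ {j} → x ≢ w j
    x≢w = Bool.not-¬ refl ∘ cong side
    x≁w : ∀ {j} → ¬ (x ~ w j)
    x≁w (inj₁ (xw , _)) = Bool.not-¬ refl xw
    x≁w (inj₂ e)        = Bool.not-¬ refl (cong (proj₁ ∘ proj₂) (sym e))

  embedding-partner : ∀ x → f (partner x) ≡ partner (f x)
  embedding-partner x = ≁⇒partner (embedding-same-side refl)
    (≢-sym partner≢ ∘ f-injective)
    (reflects λ { (inj₁ (_ , _ , ≢p)) → ≢p refl ; (inj₂ e) → mate-side x (cong side e) })

  embedding-mate : ∀ x → f (mate x) ≡ mate (f x)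
  embedding-mate x = ~⇒mate (embedding-mate-side x) (preserves (inj₂ refl))

  embedding-surjective : ∀ y → ∃[ x ] f x ≡ y
  embedding-surjective = transitive (λ y → ∃[ x ] f x ≡ y)
    (λ { _ (x , refl) → partner x , embedding-partner x })
    (λ { _ (x , refl) → mate x , embedding-mate x })
    ((false , false , zero) , refl)

Fin↔V : ∀ n → Fin (2 ℕ.* (2 ℕ.* (3 ℕ.+ n))) ↔ V n
Fin↔V n = (2↔Bool ×-↔ ((2↔Bool ×-↔ ↔-id _) ↔-∘ *↔×)) ↔-∘ *↔×

Ĝ : ℕ → Graph
Ĝ n = record
  { order  = 2 ℕ.* (2 ℕ.* (3 ℕ.+ n))
  ; _∼_    = λ u v → to u ~ to v
  ; irrefl = ~-irrefl
  ; sym    = ~-sym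
  ; _∼?_   = λ u v → to u ~? to v
  }
  where open Inverse (Fin↔V n)

module Embedding {H n} (H≼Ĝ : H ≼ Ĝ n) where

  open _≅_ (proj₂ H≼Ĝ)
  open Graph H using (_∼_; _∼?_)

  embed : Vertex H → V n
  embed = Inverse.to (Fin↔V n) ∘ element (proj₁ H≼Ĝ) ∘ to

  embed-injective : Injective _≡_ _≡_ embed
  embed-injective = Injection.injective (Inverse⇒Injection bijection)
    ∘ element-injective (proj₁ H≼Ĝ) ∘ Injection.injective (Inverse⇒Injection (Fin↔V n))

  embed-~ : ∀ u v → u ∼ v ⇔ embed u ~ embed v
  embed-~ = adjacency

  -- For a concrete `H` the implicit argument is settled by evaluating the decision procedure.
  edge : ∀ u v {_ : True (u ∼? v)} → embed u ~ embed v
  edge u v {u∼v} = Equivalence.to (embed-~ u v) (toWitness u∼v)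

  same-side : ∀ u v w {_ : True (u ∼? v)} {_ : True (u ∼? w)} {_ : True (v ∼? w)} →
    side (embed u) ≡ side (embed v)
  same-side u v w {uv} {uw} {vw} =
    triangle-side (edge u v {uv}) (edge u w {uw}) (edge v w {vw})

  no-two-non-neighbours : ∀ u v w
    {_ : False (u ≟ v)} {_ : False (u ≟ w)} {_ : False (v ≟ w)}
    {_ : False (u ∼? v)} {_ : False (u ∼? w)} →
    side (embed u) ≡ side (embed v) → side (embed u) ≢ side (embed w)
  no-two-non-neighbours u v w {u≢v} {u≢w} {v≢w} {u≁v} {u≁w} uv uw =
    distinct v≢w (non-neighbour-unique uv uw (distinct u≢v) (distinct u≢w)
      (non-edge u≁v) (non-edge u≁w))
    where
    distinct : ∀ {u v} → False (u ≟ v) → embed u ≢ embed v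
    distinct u≢v = toWitnessFalse u≢v ∘ embed-injective
    non-edge : ∀ {u v} → False (u ∼? v) → ¬ (embed u ~ embed v)
    non-edge u≁v = toWitnessFalse u≁v ∘ Equivalence.from (embed-~ _ _)

-- Embeddings are onto, so choosing preimages injects the 4(3 + n) vertices of `Ĝ n` into the 4(3 +
-- m) of `Ĝ m`.
Ĝ-≼⇒≥ : ∀ {m n} → Ĝ m ≼ Ĝ n → n ≤ m
Ĝ-≼⇒≥ {m} {n} m≼n =
  +-cancelˡ-≤ 3 n m (*-cancelˡ-≤ 2 (*-cancelˡ-≤ 2 (injective⇒≤ preimage-injective)))
  where
  open Embedding m≼n
  open Inverse (Fin↔V m) using (to; from; strictlyInverseˡ)
  module N = Inverse (Fin↔V n)
  f : V m → V n
  f = embed ∘ from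
  f-injective : Injective _≡_ _≡_ f
  f-injective {x} {y} e =
    trans (sym (strictlyInverseˡ x)) (trans (cong to (embed-injective e)) (strictlyInverseˡ y))
  f-~ : ∀ x y → x ~ y ⇔ f x ~ f y
  f-~ x y = subst₂ (λ x′ y′ → x′ ~ y′ ⇔ f x ~ f y) (strictlyInverseˡ x) (strictlyInverseˡ y)
    (embed-~ (from x) (from y))
  surjective : ∀ v → ∃[ u ] embed u ≡ N.to v
  surjective v with x , e ← embedding-surjective f f-injective f-~ (N.to v) = from x , e
  preimage-injective : Injective _≡_ _≡_ (proj₁ ∘ surjective)
  preimage-injective {u} {v} e = Injection.injective (Inverse⇒Injection (Fin↔V n))
    (trans (sym (proj₂ (surjective u))) (trans (cong embed e) (proj₂ (surjective v))))

-- The two forbidden subgraphs.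

-- Vertex 0 of the gem dominates the path 3 - 1 - 4 - 2.
gem-free : ∀ {n} → ¬ (complement (P 1 + P 4) ≼ Ĝ n)
gem-free {n} gem≼Ĝ = no-two-non-neighbours (# 3) (# 4) (# 2)
  -- These triangles put 2, 3 and 4 on the side of 0, though 3 is adjacent to neither 4 nor 2.
  (trans (sym (same-side (# 0) (# 3) (# 1))) (same-side (# 0) (# 4) (# 1)))
  (trans (sym (same-side (# 0) (# 3) (# 1))) (same-side (# 0) (# 2) (# 4)))
  where open Embedding {complement (P 1 + P 4)} {n} gem≼Ĝ

-- At most one of 1 to 4 shares the side of the isolated vertex 0, so at least three lie opposite:
-- both ends of one of the edges 1 2 and 3 4, and a vertex of the other edge, which misses them.
P₁+2P₂-free : ∀ {n} → ¬ (P 1 + 2 · P 2 ≼ Ĝ n)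
P₁+2P₂-free {n} H≼Ĝ = split (at (# 1)) (at (# 2)) (at (# 3))
  where
  open Embedding {P 1 + 2 · P 2} {n} H≼Ĝ
  At : Vertex (P 1 + 2 · P 2) → Set
  At u = side (embed (# 0)) ≡ side (embed u)
  at : ∀ u → Dec (At u)
  at u = side (embed (# 0)) Bool.≟ side (embed u)
  same-other-side : ∀ u v → ¬ At u → ¬ At v → side (embed u) ≡ side (embed v)
  same-other-side u v 0≢u 0≢v =
    trans (Bool.¬-not (≢-sym 0≢u)) (sym (Bool.¬-not (≢-sym 0≢v)))
  split : Dec (At (# 1)) → Dec (At (# 2)) → Dec (At (# 3)) → ⊥
  split (yes a₁) _ _ = no-two-non-neighbours (# 2) (# 3) (# 4)
    (same-other-side (# 2) (# 3) n₂ (no-two-non-neighbours (# 0) (# 1) (# 3) a₁))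
    (same-other-side (# 2) (# 4) n₂ (no-two-non-neighbours (# 0) (# 1) (# 4) a₁))
    where n₂ = no-two-non-neighbours (# 0) (# 1) (# 2) a₁
  split (no n₁) (yes a₂) _ = no-two-non-neighbours (# 1) (# 3) (# 4)
    (same-other-side (# 1) (# 3) n₁ (no-two-non-neighbours (# 0) (# 2) (# 3) a₂))
    (same-other-side (# 1) (# 4) n₁ (no-two-non-neighbours (# 0) (# 2) (# 4) a₂))
  split (no n₁) (no n₂) (yes a₃) = no-two-non-neighbours (# 4) (# 1) (# 2)
    (same-other-side (# 4) (# 1) n₄ n₁) (same-other-side (# 4) (# 2) n₄ n₂)
    where n₄ = no-two-non-neighbours (# 0) (# 3) (# 4) a₃
  -- Here 1, 2 and 3 are three such vertices, wherever 4 lies.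
  split (no n₁) (no n₂) (no n₃) = no-two-non-neighbours (# 3) (# 1) (# 2)
    (same-other-side (# 3) (# 1) n₃ n₁) (same-other-side (# 3) (# 2) n₃ n₂)

theorem4 : ¬ ClassWellQuasiOrdered (Free (complement (P 1 + P 4) ∷ P 1 + 2 · P 2 ∷ []))
theorem4 wqo
  with i , j , i<j , i≼j ← wqo (λ n → Ĝ n , gem-free ∷ P₁+2P₂-free ∷ []) =
  <⇒≱ i<j (Ĝ-≼⇒≥ i≼j)
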